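{- Let $\mathcal E$ be a finite set of edge-colored graphs with colors in $[r]$ such that: (i) the class of $\mathcal E$-free edge-colored graphs is closed under amalgamation over vertices, i.e., whenever $(G_1,\gamma_1)$ and $(G_2,\gamma_2)$ are $\mathcal E$-free and $v_1\in V(G_1)$, $v_2\in V(G_2)$, the edge-colored graph obtained from the disjoint union of $(G_1,\gamma_1)$ and $(G_2,\gamma_2)$ by identifying $v_1$ with $v_2$ is $\mathcal E$-free; (ii) for every $K\geq 1$ there exists a finite graph $G$ that admits no $\mathcal E$-free edge-coloring, but every subgraph of $G$ with at most $K$ vertices admits an $\mathcal E$-free edge-coloring. Then there is no finite set $\mathcal F$ of vertex-colored graphs such that $\mathrm{Col}(\mathcal F)=\mathrm{Col}(\mathcal E)$, i.e., such that a finite graph admits an $\mathcal F$-free vertex-coloring if and only if it admits an $\mathcal E$-free edge-coloring.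
   Context: All graphs are finite, simple and undirected. An edge-colored graph is $(G,\gamma)$ with $\gamma:E(G)\to[r]$; it is $\mathcal E$-free if there is no $(E,\theta)\in\mathcal E$ and no graph homomorphism $h:E\to G$ with $\gamma(\{h(u),h(v)\})=\theta(\{u,v\})$ for all edges $\{u,v\}$ of $E$. $\mathrm{Col}(\mathcal E)$ is the class of finite graphs $G$ admitting $\gamma:E(G)\to[r]$ with $(G,\gamma)$ $\mathcal E$-free. A vertex-colored graph is $(F,\varphi)$ with $\varphi:V(F)\to[s]$ for some fixed finite color set $[s]$. For a finite set $\mathcal F$ of vertex-colored graphs, a vertex-coloring $c:V(G)\to[s]$ of a graph $G$ is $\mathcal F$-free if there is no $(F,\varphi)\in\mathcal F$ and no graph homomorphism $h:F\to G$ with $c\circ h=\varphi$; $\mathrm{Col}(\mathcal F)$ is the class of finite graphs admitting an $\mathcal F$-free vertex-coloring. -}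

module Defs where

open import Data.Nat using (ℕ; _≤_)
open import Data.Fin using (Fin)
open import Data.Bool using (Bool; true; false)
open import Data.List using (List)
open import Data.List.Membership.Propositional using (_∈_)
open import Data.Product using (Σ; ∃; _×_; _,_)
open import Data.Sum using (_⊎_)
open import Relation.Nullary using (¬_)
open import Relation.Binary.PropositionalEquality using (_≡_)
open import Function.Bundles using (_⇔_)

record Graph : Set where
  field
    n      : ℕ
    adj    : Fin n → Fin n → Bool
    sym    : ∀ u v → adj u v ≡ adj v u
    irrefl : ∀ u → adj u u ≡ false
open Graph public

V : Graph → Set
V G = Fin (n G)

Adj : (G : Graph) → V G → V G → Set
Adj G u v = adj G u v ≡ true

IsHom : (F G : Graph) → (V F → V G) → Set
IsHom F G h = ∀ u v → Adj F u v → Adj G (h u) (h v)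

Injective : {A B : Set} → (A → B) → Set
Injective f = ∀ x y → f x ≡ f y → x ≡ y

-- Edge-colored graph with colors in [r] = Fin r.  The coloring is given on
-- ordered pairs; only its values on edges matter, and it is symmetric there,
-- so it is a function E(G) → [r].
record ECGraph (r : ℕ) : Set where
  field
    graph   : Graph
    col     : V graph → V graph → Fin r
    col-sym : ∀ u v → Adj graph u v → col u v ≡ col v u
open ECGraph public

EFree : {r : ℕ} → List (ECGraph r) → ECGraph r → Set
EFree {r} ℰ Gγ = ∀ (Eθ : ECGraph r) → Eθ ∈ ℰ →
  ¬ (Σ (V (graph Eθ) → V (graph Gγ)) λ h →
       IsHom (graph Eθ) (graph Gγ) h ×
       (∀ u v → Adj (graph Eθ) u v → col Gγ (h u) (h v) ≡ col Eθ u v))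

ColE : {r : ℕ} → List (ECGraph r) → Graph → Set
ColE {r} ℰ G = Σ (V G → V G → Fin r) λ γ →
  Σ (∀ u v → Adj G u v → γ u v ≡ γ v u) λ s →
    EFree ℰ (record { graph = G ; col = γ ; col-sym = s })

-- G is (isomorphic to) the edge-colored graph obtained from the disjoint union
-- of G₁ and G₂ by identifying v₁ with v₂; f₁, f₂ are the canonical embeddings.
record IsAmalgam {r : ℕ} (G₁ G₂ G : ECGraph r)
                 (v₁ : V (graph G₁)) (v₂ : V (graph G₂)) : Set where
  field
    f₁ : V (graph G₁) → V (graph G)
    f₂ : V (graph G₂) → V (graph G)
    f₁-inj : Injective f₁
    f₂-inj : Injective f₂
    glue : f₁ v₁ ≡ f₂ v₂
    meet : ∀ x y → f₁ x ≡ f₂ y → (x ≡ v₁) × (y ≡ v₂)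
    cover : ∀ w → (∃ λ x → f₁ x ≡ w) ⊎ (∃ λ y → f₂ y ≡ w)
    adj₁ : ∀ x y → Adj (graph G) (f₁ x) (f₁ y) ⇔ Adj (graph G₁) x y
    adj₂ : ∀ x y → Adj (graph G) (f₂ x) (f₂ y) ⇔ Adj (graph G₂) x y
    edges : ∀ a b → Adj (graph G) a b →
      (∃ λ x → ∃ λ y → f₁ x ≡ a × f₁ y ≡ b) ⊎
      (∃ λ x → ∃ λ y → f₂ x ≡ a × f₂ y ≡ b)
    col₁ : ∀ x y → Adj (graph G₁) x y → col G (f₁ x) (f₁ y) ≡ col G₁ x y
    col₂ : ∀ x y → Adj (graph G₂) x y → col G (f₂ x) (f₂ y) ≡ col G₂ x y

AmalgamationClosed : {r : ℕ} → List (ECGraph r) → Set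
AmalgamationClosed {r} ℰ = ∀ (G₁ G₂ G : ECGraph r) v₁ v₂ →
  EFree ℰ G₁ → EFree ℰ G₂ → IsAmalgam G₁ G₂ G v₁ v₂ → EFree ℰ G

IsSubgraph : Graph → Graph → Set
IsSubgraph H G = Σ (V H → V G) λ f → Injective f × IsHom H G f

NotLocallyDetermined : {r : ℕ} → List (ECGraph r) → Set
NotLocallyDetermined ℰ = ∀ (K : ℕ) → 1 ≤ K → Σ Graph λ G →
  ¬ ColE ℰ G × (∀ H → IsSubgraph H G → n H ≤ K → ColE ℰ H)

record VCGraph (s : ℕ) : Set where
  field
    vgraph : Graph
    vcol   : V vgraph → Fin s
open VCGraph public

ColF : {s : ℕ} → List (VCGraph s) → Graph → Set
ColF {s} ℱ G = Σ (V G → Fin s) λ c →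
  ∀ (Fφ : VCGraph s) → Fφ ∈ ℱ →
    ¬ (Σ (V (vgraph Fφ) → V G) λ h →
         IsHom (vgraph Fφ) G h × (∀ u → c (h u) ≡ vcol Fφ u))

{-# OPTIONS --safe #-}

-- Suppose Col(ℱ) = Col(ℰ), and choose G ∉ Col(ℰ) whose subgraphs of size at
-- most that of the members of ℱ are all in Col(ℰ).  Start from a disjoint union
-- of ℰ-free coloured copies of these subgraphs, with vertices labelled by those
-- of G.  For one label after another, amalgamate copies of the graph obtained so
-- far along a hypergraph of large girth and chromatic number, whose blocks
-- are the sets of vertices carrying that label (Nešetřil and Rödl's partite
-- construction).  In the end every vertex-colouring has a copy of the initial
-- graph on which colours only depend on labels, hence comes from a colouring of
-- G and is not ℱ-free.  But a small piece of the final graph lies in copies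
-- glued along a hyperforest, so closure under amalgamation over vertices keeps
-- the graph ℰ-free.  The sparse hypergraphs come from the same construction.
module Submission where

open import Defs
open import Data.Nat using (ℕ; zero; suc; _≤_; _<_; _*_; _^_; z≤n; s≤s; s≤s⁻¹)
open import Data.Nat.Properties as ℕₚ using (≤-refl; ≤-trans; m<1+n⇒m<n∨m≡n)
open import Data.Bool as Bool using (Bool; true; false; _∧_)
open import Data.Fin as Fin using (Fin; zero; suc; toℕ; fromℕ<; inject≤; inject₁; punchIn; punchOut;
  combine; remQuot; finToFun; funToFin)
open import Data.Fin.Properties as Finₚ using (punchOut-injective; toℕ-injective; toℕ-fromℕ<; toℕ<n;
  finToFun-funToFin; +↔⊎; *↔×; inj⇒≟)
open import Data.List using (List; []; _∷_; length; map; filter; tabulate)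
open import Data.List.Extrema ℕₚ.≤-totalOrder using (max; xs≤max)
open import Data.List.Membership.Propositional using (_∈_; lose; find)
open import Data.List.Membership.Propositional.Properties
  using (∈-map⁺; ∈-map⁻; ∈-filter⁺; ∈-filter⁻; ∈-tabulate⁺)
open import Data.List.Properties using (length-map; length-filter; filter-notAll; length-tabulate)
open import Data.List.Relation.Unary.Any as Any using (here)
open import Data.Product using (Σ; ∃; _×_; _,_; proj₁; proj₂)
open import Data.Product.Function.NonDependent.Propositional using (_×-↔_)
open import Data.Product.Properties using (≡-dec)
open import Data.Sum using (_⊎_; inj₁; inj₂)
open import Data.Sum.Function.Propositional using (_⊎-↔_)
open import Data.Sum.Properties using (inj₁-injective; inj₂-injective)
open import Function using (_∘_; id)
open import Function.Bundles using (_⇔_; _↔_; Inverse; Equivalence; mk⇔)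
open import Function.Properties.Inverse using (↔-refl; ↔-sym; ↔-trans; ↔⇒↣)
open import Relation.Binary.Definitions using (DecidableEquality)
open import Relation.Binary.PropositionalEquality using (_≡_; _≢_; refl; trans; cong; cong₂; subst)
  renaming (sym to ≡-sym)
open import Relation.Nullary using (¬_; Dec; yes; no; does; contradiction; ¬?; _×-dec_)
open import Relation.Nullary.Decidable using (map′; decidable-stable; dec-true; dec-false; does-⇔)
open import Relation.Unary using (Decidable)
import Data.List.Relation.Unary.All as All
import Data.Vec.Functional as VecF

-- Finite types and search in them.

Finite : Set → Set
Finite A = ∃ λ k → A ↔ Fin k

∣_∣ : ∀ {A} → Finite A → ℕ
∣ k , _ ∣ = k

encode : ∀ {A} (fin : Finite A) → A → Fin ∣ fin ∣
encode (_ , A↔k) = Inverse.to A↔k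

decode : ∀ {A} (fin : Finite A) → Fin ∣ fin ∣ → A
decode (_ , A↔k) = Inverse.from A↔k

decode-encode : ∀ {A} (fin : Finite A) x → decode fin (encode fin x) ≡ x
decode-encode (_ , A↔k) = Inverse.strictlyInverseʳ A↔k

encode-decode : ∀ {A} (fin : Finite A) i → encode fin (decode fin i) ≡ i
encode-decode (_ , A↔k) = Inverse.strictlyInverseˡ A↔k

encode-injective : ∀ {A} (fin : Finite A) {x y} → encode fin x ≡ encode fin y → x ≡ y
encode-injective fin {x} {y} eq =
  trans (≡-sym (decode-encode fin x)) (trans (cong (decode fin) eq) (decode-encode fin y))

finite-Fin : ∀ {k} → Finite (Fin k)
finite-Fin = _ , ↔-refl

abstract

  finite-⊎ : ∀ {A B} → Finite A → Finite B → Finite (A ⊎ B)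
  finite-⊎ (_ , A↔k) (_ , B↔l) = _ , ↔-trans (A↔k ⊎-↔ B↔l) (↔-sym +↔⊎)

  finite-× : ∀ {A B} → Finite A → Finite B → Finite (A × B)
  finite-× (_ , A↔k) (_ , B↔l) = _ , ↔-trans (A↔k ×-↔ B↔l) (↔-sym *↔×)

  finite-≟ : ∀ {A} → Finite A → DecidableEquality A
  finite-≟ (_ , A↔k) = inj⇒≟ (↔⇒↣ A↔k)

  finite-any? : ∀ {A} → Finite A → {P : A → Set} → Decidable P → Dec (∃ P)
  finite-any? fin {P} P? = map′
    (λ (i , p) → decode fin i , p)
    (λ (x , p) → encode fin x , subst P (≡-sym (decode-encode fin x)) p)
    (Finₚ.any? (P? ∘ decode fin))

any∈? : ∀ {A : Set} {P : A → Set} → Decidable P → (L : List A) → Dec (∃ λ x → x ∈ L × P x)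
any∈? P? L = map′ find (λ (_ , x∈L , p) → lose x∈L p) (Any.any? P? L)

-- Hypergraphs: hyperforests and chromatic number.

-- A family of blocks at b : U b → X is thought of as a hypergraph on X.
module _ {B X : Set} {U : B → Set} (at : ∀ b → U b → X) where

  _∋_ : B → X → Set
  b ∋ x = ∃ λ u → at b u ≡ x

  Shared : List B → B → X → Set
  Shared L b x = b ∋ x × ∃ λ b′ → b′ ∈ L × b′ ≢ b × b′ ∋ x

  -- A block that shares no point is a leaf too, and repetitions in `L` do not matter.
  Leaf : List B → B → Set
  Leaf L b = ∀ x y → Shared L b x → Shared L b y → x ≡ y

  -- Any ℓ blocks form a hyperforest.  A leaf other than a prescribed block b₀ is
  -- asked for, since the mere existence of a leaf is not inherited by the partite
  -- amalgamation below.
  Acyclic : ℕ → Set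
  Acyclic ℓ = ∀ L → length L ≤ ℓ → ∀ b₀ b₁ → b₀ ∈ L → b₁ ∈ L → b₁ ≢ b₀ →
    ∃ λ b → b ∈ L × b ≢ b₀ × Leaf L b

record Hypergraph (U : Set) : Set₁ where
  field
    Point Block : Set
    finitePoint : Finite Point
    finiteBlock : Finite Block
    at          : Block → U → Point
    at-inj      : ∀ b → Injective (at b)

  Monochromatic : ∀ {s} → (Point → Fin s) → Set
  Monochromatic c = ∃ λ b → ∀ u v → c (at b u) ≡ c (at b v)

  Chromatic> : ℕ → Set
  Chromatic> s = ∀ (c : Point → Fin s) → Monochromatic c

open Hypergraph

-- Take a copy of the hypergraph for s colours for each u : U, and all
-- transversals of these copies: either some copy avoids the colour zero, or the
-- points of colour zero contain a transversal.
chromatic-hypergraph : ∀ s {U} → Finite U → Σ (Hypergraph U) λ H → Chromatic> H s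
-- With one point and no colours, there is no colouring to consider.
chromatic-hypergraph zero finU = record
  { Point = Fin 1 ; Block = Fin 0 ; finitePoint = finite-Fin ; finiteBlock = finite-Fin
  ; at = λ () ; at-inj = λ () } , λ c → contradiction (c zero) λ ()
chromatic-hypergraph (suc s) {U} finU with H , chromatic ← chromatic-hypergraph s finU = H⁺ , chromatic⁺
  where
  p = ∣ finitePoint H ∣
  k = ∣ finU ∣

  -- Transversals are given by codes of functions `U → Point H`, since the functions themselves do
  -- not form a `Finite` type without extensionality.
  at⁺ : (U × Block H) ⊎ Fin (p ^ k) → U → U × Point H
  at⁺ (inj₁ (w , b)) u = w , at H b u
  at⁺ (inj₂ f)       u = u , decode (finitePoint H) (finToFun {p} {k} f (encode finU u))

  at⁺-inj : ∀ b → Injective (at⁺ b)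
  at⁺-inj (inj₁ (w , b)) u v eq = at-inj H b u v (cong proj₂ eq)
  at⁺-inj (inj₂ f)       u v eq = cong proj₁ eq

  H⁺ : Hypergraph U
  H⁺ = record
    { finitePoint = finite-× finU (finitePoint H)
    ; finiteBlock = finite-⊎ (finite-× finU (finiteBlock H)) finite-Fin
    ; at = at⁺ ; at-inj = at⁺-inj }

  chromatic⁺ : Chromatic> H⁺ (suc s)
  chromatic⁺ c with finite-any? finU (λ w → ¬? (finite-any? (finitePoint H) (λ x → c (w , x) Fin.≟ zero)))
  ... | yes (w , avoids) = let b , mono = chromatic (λ x → punchOut (≢0 x)) in
      inj₁ (w , b) , λ u v → punchOut-injective (≢0 (at H b u)) (≢0 (at H b v)) (mono u v)
    where
    ≢0 : ∀ x → zero ≢ c (w , x)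
    ≢0 x eq = avoids (x , ≡-sym eq)
  ... | no all-hit = inj₂ f , λ u v → trans (f-zero u) (≡-sym (f-zero v))
    where
    hit : ∀ w → ∃ λ x → c (w , x) ≡ zero
    hit w = decidable-stable (finite-any? (finitePoint H) λ x → c (w , x) Fin.≟ zero) λ ¬hit → all-hit (w , ¬hit)
    f = funToFin λ i → encode (finitePoint H) (proj₁ (hit (decode finU i)))
    f-zero : ∀ u → c (at⁺ (inj₂ f) u) ≡ zero
    f-zero u rewrite finToFun-funToFin (λ i → encode (finitePoint H) (proj₁ (hit (decode finU i)))) (encode finU u)
      | decode-encode finU u | decode-encode (finitePoint H) (proj₁ (hit u)) = proj₂ (hit u)

-- The partite construction, for hypergraphs and graphs alike.

-- Partite amalgamation: a copy of X for each block of H, where the points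
-- labelled i of a copy are placed on the block and all others are kept disjoint.
module PartiteAmalgam {X A : Set} (_≟_ : DecidableEquality A) (lab : X → A) (i : A) (H : Hypergraph X) where

  -- To avoid subtypes, the blocks of `H` are indexed by all of `X` and not only by the points
  -- labelled `i`, and the points `inj₂ (e , u)` with `lab u ≡ i` stay behind as isolated points.
  Glued : Set
  Glued = Point H ⊎ (Block H × X)

  finiteGlued : Finite X → Finite Glued
  finiteGlued finX = finite-⊎ (finitePoint H) (finite-× (finiteBlock H) finX)

  copy : Block H → X → Glued
  copy e u with lab u ≟ i
  ... | yes _ = inj₁ (at H e u)
  ... | no  _ = inj₂ (e , u)

  label : Glued → A
  label (inj₁ _)       = i
  label (inj₂ (_ , u)) = lab u

  label-copy : ∀ e u → label (copy e u) ≡ lab u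
  label-copy e u with lab u ≟ i
  ... | yes eq = ≡-sym eq
  ... | no  _  = refl

  copy-i : ∀ e u → lab u ≡ i → copy e u ≡ inj₁ (at H e u)
  copy-i e u eq with lab u ≟ i
  ... | yes _ = refl
  ... | no ≢i = contradiction eq ≢i

  copy-inj : ∀ e → Injective (copy e)
  copy-inj e u v eq with lab u ≟ i | lab v ≟ i
  ... | yes _ | yes _ = at-inj H e u v (inj₁-injective eq)
  ... | no _  | no _  = cong proj₂ (inj₂-injective eq)
  ... | yes _ | no _  = contradiction eq λ ()
  ... | no _  | yes _ = contradiction eq λ ()

  copy-meet : ∀ {e e′ u v} → e ≢ e′ → copy e u ≡ copy e′ v →
    lab u ≡ i × lab v ≡ i × at H e u ≡ at H e′ v
  copy-meet {u = u} {v} e≢e′ eq with lab u ≟ i | lab v ≟ i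
  ... | yes p | yes q = p , q , inj₁-injective eq
  ... | no _  | no _  = contradiction (cong proj₁ (inj₂-injective eq)) e≢e′
  ... | yes _ | no _  = contradiction eq λ ()
  ... | no _  | yes _ = contradiction eq λ ()

  copy-mono : ∀ {s} → Chromatic> H s → (c : Glued → Fin s) →
    ∃ λ e → ∀ u v → lab u ≡ i → lab v ≡ i → c (copy e u) ≡ c (copy e v)
  copy-mono chromatic c = let e , mono = chromatic (c ∘ inj₁) in
    e , λ u v pu pv → trans (cong c (copy-i e u pu)) (trans (mono u v) (cong c (≡-sym (copy-i e v pv))))

  -- Different copies only meet in points of `H`, where their blocks meet as well, so a leaf among
  -- the blocks is a leaf among the copies.
  copy-acyclic : ∀ {ℓ} → Acyclic (at H) ℓ → Acyclic copy ℓ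
  copy-acyclic acyclic L L≤ b₀ b₁ b₀∈ b₁∈ b₁≢b₀ with b , b∈ , b≢ , leaf ← acyclic L L≤ b₀ b₁ b₀∈ b₁∈ b₁≢b₀ =
    b , b∈ , b≢ , λ x y sx sy →
      let z , x≡z , sz = on-block sx
          w , y≡w , sw = on-block sy
      in trans x≡z (trans (cong inj₁ (leaf z w sz sw)) (≡-sym y≡w))
    where
    on-block : ∀ {x} → Shared copy L b x → ∃ λ z → x ≡ inj₁ z × Shared (at H) L b z
    on-block ((u , refl) , b′ , b′∈ , b′≢ , v , eq) with _ , pu , same ← copy-meet b′≢ eq =
      at H b u , copy-i b u pu , (u , refl) , b′ , b′∈ , b′≢ , v , same

ConstantBelow : ∀ {X : Set} {a s} → (X → Fin a) → ℕ → (X → Fin s) → Set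
ConstantBelow lab j c = ∀ u v → lab u ≡ lab v → toℕ (lab u) < j → c u ≡ c v

module _ {i} {S : Set i} {a s : ℕ} (Pt : S → Set) (lab : ∀ X → Pt X → Fin a)
  (Bad : ∀ X → (Pt X → Fin s) → Set) where

  -- Common form of the amalgamation step. For hypergraphs a colouring will be bad if some block is
  -- monochromatic, for graphs if it is not ℱ-free.
  Step : S → Fin a → S → Set
  Step X i X′ = ∀ c → ∃ λ (κ : Pt X → Pt X′) →
    (∀ u → lab X′ (κ u) ≡ lab X u) ×
    (∀ u v → lab X u ≡ i → lab X v ≡ i → c (κ u) ≡ c (κ v)) ×
    (Bad X (c ∘ κ) → Bad X′ c)

  -- Labels are treated from the highest to the lowest. After the step for label `j`, a colouring
  -- constant on the labels below `j` restricts to some copy as one constant below `suc j`; at zero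
  -- nothing is left to assume.
  iterate-step : (∀ X i → ∃ (Step X i)) → ∀ {j} → j ≤ a → ∀ X →
    (∀ c → ConstantBelow (lab X) j c → Bad X c) → ∃ λ X′ → ∀ c → Bad X′ c
  iterate-step step {zero}  _   X bad = X , λ c → bad c λ _ _ _ ()
  iterate-step step {suc j} j<a X bad with X′ , embed ← step X (fromℕ< j<a) =
    iterate-step step (ℕₚ.<⇒≤ j<a) X′ bad′
    where
    bad′ : ∀ c → ConstantBelow (lab X′) j c → Bad X′ c
    bad′ c const with κ , label , mono , extend ← embed c = extend (bad (c ∘ κ) const⁺)
      where
      const⁺ : ConstantBelow (lab X) (suc j) (c ∘ κ)
      const⁺ u v eq lt with m<1+n⇒m<n∨m≡n lt
      ... | inj₁ <j = const (κ u) (κ v) (trans (label u) (trans eq (≡-sym (label v))))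
                        (subst (_< j) (≡-sym (cong toℕ (label u))) <j)
      ... | inj₂ ≡j = mono u v u≡j (trans (≡-sym eq) u≡j)
        where
        u≡j : lab X u ≡ fromℕ< j<a
        u≡j = toℕ-injective (trans ≡j (≡-sym (toℕ-fromℕ< j<a)))

-- Sparse hypergraphs of large chromatic number.

record PartiteHypergraph (U : Set) (a ℓ : ℕ) : Set₁ where
  field
    hyp         : Hypergraph U
    lab         : Point hyp → Fin a
    transversal : ∀ b → Injective (lab ∘ at hyp b)
    acyclic     : Acyclic (at hyp) ℓ

open PartiteHypergraph

-- A block alone in its copy is a leaf by transversality.  Otherwise some copy
-- contains two of the blocks, so there are fewer copies than blocks, and this is
-- why H needs to be acyclic only up to ℓ.
module AmalgamAcyclic {U : Set} {a ℓ : ℕ} (P : PartiteHypergraph U a (suc ℓ)) (i : Fin a)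
  (H : Hypergraph (Point (hyp P))) (H-acyclic : Acyclic (at H) ℓ) (finU : Finite U) where

  open PartiteAmalgam Fin._≟_ (lab P) i H public

  at⁺ : Block H × Block (hyp P) → U → Glued
  at⁺ (e , b) u = copy e (at (hyp P) b u)

  at⁺-inj : ∀ b → Injective (at⁺ b)
  at⁺-inj (e , b) u v eq = at-inj (hyp P) b u v (copy-inj e _ _ eq)

  _≟H_ = finite-≟ (finiteBlock H)
  _≟P_ = finite-≟ (finiteBlock (hyp P))
  _≟G_ = finite-≟ (finiteGlued (finitePoint (hyp P)))

  _≟⁺_ : DecidableEquality (Block H × Block (hyp P))
  _≟⁺_ = ≡-dec _≟H_ _≟P_

  Foreign : List (Block H × Block (hyp P)) → Block H → Glued → Set
  Foreign L e x = ∃ λ d → d ∈ L × proj₁ d ≢ e × _∋_ at⁺ d x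

  -- Contacts with other copies do no harm at points that are shared inside the copy already: all
  -- sharing then comes from `Lₑ`, and the copy is embedded injectively.
  local-leaf : ∀ L e (Lₑ : List (Block (hyp P))) b → Leaf (at (hyp P)) Lₑ b →
    (∀ {c} → (e , c) ∈ L → c ∈ Lₑ) →
    (∀ x → _∋_ at⁺ (e , b) x → Foreign L e x → ∃ λ c → c ∈ Lₑ × c ≢ b × _∋_ at⁺ (e , c) x) →
    Leaf at⁺ L (e , b)
  local-leaf L e Lₑ b leaf complete attach x y sx sy = conclude (local x sx) (local y sy)
    where
    Local : Glued → Set
    Local x = _∋_ at⁺ (e , b) x × ∃ λ c → c ∈ Lₑ × c ≢ b × _∋_ at⁺ (e , c) x
    local : ∀ x → Shared at⁺ L (e , b) x → Local x
    local x (b∋x , (e′ , c) , c∈ , c≢ , c∋x) with e′ ≟H e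
    ... | yes refl = b∋x , c , complete c∈ , (λ { refl → c≢ refl }) , c∋x
    ... | no e′≢e  = b∋x , attach x b∋x ((e′ , c) , c∈ , e′≢e , c∋x)
    conclude : ∀ {x y} → Local x → Local y → x ≡ y
    conclude ((u , refl) , c , c∈ , c≢ , u′ , eu) ((v , refl) , d , d∈ , d≢ , v′ , ev) =
      cong (copy e) (leaf _ _ ((u , refl) , c , c∈ , c≢ , u′ , copy-inj e _ _ eu)
                              ((v , refl) , d , d∈ , d≢ , v′ , copy-inj e _ _ ev))

  foreign-H : ∀ L {x} e c → _∋_ at⁺ (e , c) x → Foreign L e x →
    ∃ λ z → x ≡ inj₁ z × _∋_ (at H) e z × ∃ λ d → d ∈ L × proj₁ d ≢ e × _∋_ (at H) (proj₁ d) z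
  foreign-H L e c (u , refl) ((e′ , d) , d∈ , e′≢e , v , eq)
    with _ , pu , same ← copy-meet e′≢e eq =
    at H e (at (hyp P) c u) , copy-i e _ pu , (_ , refl) , (e′ , d) , d∈ , e′≢e , (_ , same)

  -- Every point shared with another copy has label `i`, and a transversal block has at most one
  -- such point.
  single-leaf : ∀ L e b → (∀ {c} → (e , c) ∈ L → c ≡ b) → Leaf at⁺ L (e , b)
  single-leaf L e b single x y sx sy =
    let u , eu , pu = labelled x sx
        v , ev , pv = labelled y sy
    in trans (≡-sym eu) (trans (cong (at⁺ (e , b)) (transversal P b u v (trans pu (≡-sym pv)))) ev)
    where
    labelled : ∀ x → Shared at⁺ L (e , b) x → ∃ λ u → at⁺ (e , b) u ≡ x × lab P (at (hyp P) b u) ≡ i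
    labelled x ((u , eu) , (e′ , c) , c∈ , c≢ , v , ev) with e′ ≟H e
    ... | yes refl = contradiction (cong (e ,_) (single c∈)) c≢
    ... | no e′≢e  = u , eu , proj₁ (copy-meet (e′≢e ∘ ≡-sym) (trans eu (≡-sym ev)))

  fibre : List (Block H × Block (hyp P)) → Block H → List (Block (hyp P))
  fibre L e = map proj₂ (filter ((_≟H e) ∘ proj₁) L)

  ∈-fibre⁺ : ∀ {L e c} → (e , c) ∈ L → c ∈ fibre L e
  ∈-fibre⁺ {e = e} c∈ = ∈-map⁺ proj₂ (∈-filter⁺ ((_≟H e) ∘ proj₁) c∈ refl)

  ∈-fibre⁻ : ∀ {L e c} → c ∈ fibre L e → (e , c) ∈ L
  ∈-fibre⁻ {L} {e} c∈ with ∈-map⁻ proj₂ c∈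
  ... | (_ , _) , d∈ , refl with ∈-filter⁻ ((_≟H e) ∘ proj₁) {xs = L} d∈
  ... | d∈L , refl = d∈L

  fibre-length : ∀ L e → length (fibre L e) ≤ length L
  fibre-length L e = ≤-trans (ℕₚ.≤-reflexive (length-map proj₂ (filter ((_≟H e) ∘ proj₁) L)))
    (length-filter ((_≟H e) ∘ proj₁) L)

  -- Let `c` contain all contacts with other copies. A leaf `b` other than `c` inside the copy
  -- shares each of its contact points with `c`, so `local-leaf` applies. For this the leaf has to
  -- avoid a prescribed block.
  copy-leaf : ∀ L → length L ≤ suc ℓ → ∀ e c c′ → (e , c) ∈ L → (e , c′) ∈ L → c′ ≢ c →
    (∀ x → Foreign L e x → ∃ (λ d → _∋_ at⁺ (e , d) x × (e , d) ∈ L) → _∋_ at⁺ (e , c) x) →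
    ∃ λ b → b ≢ c × (e , b) ∈ L × Leaf at⁺ L (e , b)
  copy-leaf L L≤ e c c′ c∈ c′∈ c′≢c root
    with b , b∈ , b≢ , leaf ← acyclic P (fibre L e)
           (≤-trans (fibre-length L e) L≤) c c′ (∈-fibre⁺ c∈) (∈-fibre⁺ c′∈) c′≢c =
    b , b≢ , ∈-fibre⁻ b∈ , local-leaf L e (fibre L e) b leaf ∈-fibre⁺
      λ x b∋x foreign → c , ∈-fibre⁺ c∈ , b≢ ∘ ≡-sym , root x foreign (b , b∋x , ∈-fibre⁻ b∈)

  Attached : List (Block H × Block (hyp P)) → Block H → Block H × Block (hyp P) → Set
  Attached L e d = proj₁ d ≡ e × ∃ λ d′ → d′ ∈ L × proj₁ d′ ≢ e × ∃ λ u → ∃ λ v → at⁺ d′ v ≡ at⁺ d u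

  attached? : ∀ L e → Decidable (Attached L e)
  attached? L e d = (proj₁ d ≟H e) ×-dec any∈? (λ d′ → ¬? (proj₁ d′ ≟H e) ×-dec
    finite-any? finU λ u → finite-any? finU λ v → at⁺ d′ v ≟G at⁺ d u) L

  -- As `e` is a leaf of `H`, the blocks of `L` in its copy meet those in other copies in at most
  -- one point. A block through that point, if there is one, serves as the prescribed block in
  -- `copy-leaf`.
  H-leaf-case : ∀ L → length L ≤ suc ℓ → ∀ e → Leaf (at H) (map proj₁ L) e →
    ∀ c c′ → (e , c) ∈ L → (e , c′) ∈ L → c′ ≢ c →
    ∃ λ b → (e , b) ∈ L × Leaf at⁺ L (e , b)
  H-leaf-case L L≤ e leafH c c′ c∈ c′∈ c′≢c with any∈? (attached? L e) L
  ... | no ¬attached =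
    let b , _ , b∈ , leaf = copy-leaf L L≤ e c c′ c∈ c′∈ c′≢c
          λ { x (d′ , d′∈ , d′≢ , v , ev) (d , (u , eu) , d∈) →
              contradiction ((e , d) , d∈ , refl , d′ , d′∈ , d′≢ , u , v , trans ev (≡-sym eu)) ¬attached }
    in b , b∈ , leaf
  ... | yes ((_ , d) , d∈ , refl , d′ , d′∈ , d′≢ , u , v , eq) =
    let b , _ , b∈ , leaf = copy-leaf L L≤ e d (proj₁ other) d∈ (proj₁ (proj₂ other)) (proj₂ (proj₂ other)) root
    in b , b∈ , leaf
    where
    other : ∃ λ d₁ → (e , d₁) ∈ L × d₁ ≢ d
    other with c ≟P d
    ... | no c≢d   = c , c∈ , c≢d
    ... | yes refl = c′ , c′∈ , c′≢c
    root : ∀ x → Foreign L e x → ∃ (λ d₁ → _∋_ at⁺ (e , d₁) x × (e , d₁) ∈ L) → _∋_ at⁺ (e , d) x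
    root x foreign (d₁ , d₁∋x , _)
      with z , refl , e∋z , f , f∈ , f≢ , f∋z ← foreign-H L e d₁ d₁∋x foreign
         | y , eqy , e∋y , g , g∈ , g≢ , g∋y ← foreign-H L e d (u , refl) (d′ , d′∈ , d′≢ , v , eq) =
      u , trans eqy (cong inj₁ (leafH y z (e∋y , _ , ∈-map⁺ proj₁ g∈ , g≢ , g∋y)
        (e∋z , _ , ∈-map⁺ proj₁ f∈ , f≢ , f∋z)))

  Twin : List (Block H × Block (hyp P)) → Block H × Block (hyp P) → Set
  Twin L d = ∃ λ d′ → d′ ∈ L × proj₁ d′ ≡ proj₁ d × d′ ≢ d

  twin? : ∀ L → Decidable (Twin L)
  twin? L d = any∈? (λ d′ → (proj₁ d′ ≟H proj₁ d) ×-dec ¬? (d′ ≟⁺ d)) L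

  twins : ∀ {L e₀} → ¬ (∃ λ d → d ∈ L × proj₁ d ≢ e₀ × ¬ Twin L d) →
    ∀ {d} → d ∈ L → proj₁ d ≢ e₀ → Twin L d
  twins none-alone {d} d∈ ≢e₀ = decidable-stable (twin? _ d) λ alone → none-alone (d , d∈ , ≢e₀ , alone)

  remove : List (Block H × Block (hyp P)) → Block H × Block (hyp P) → List (Block H × Block (hyp P))
  remove L d = filter (λ d′ → ¬? (d′ ≟⁺ d)) L

  remove-shortens : ∀ {L d} → d ∈ L → length (map proj₁ (remove L d)) < length L
  remove-shortens {L} {d} d∈ = subst (_< length L) (≡-sym (length-map proj₁ (remove L d)))
    (filter-notAll (λ d′ → ¬? (d′ ≟⁺ d)) L (lose d∈ λ d≢d → d≢d refl))

  -- The copy `e` still contains `b`, so dropping `c` shortens the list without losing a copy.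
  remove-covers : ∀ {L e b c} → (e , b) ∈ L → (e , b) ≢ (e , c) →
    ∀ {d} → d ∈ L → proj₁ d ∈ map proj₁ (remove L (e , c))
  remove-covers {e = e} {c = c} b∈ b≢c {d} d∈ with d ≟⁺ (e , c)
  ... | yes refl = ∈-map⁺ proj₁ (∈-filter⁺ (λ d′ → ¬? (d′ ≟⁺ (e , c))) b∈ b≢c)
  ... | no d≢    = ∈-map⁺ proj₁ (∈-filter⁺ (λ d′ → ¬? (d′ ≟⁺ (e , c))) d∈ d≢)

  enlarge : ∀ {L e b c} → (e , b) ∈ L → (e , b) ≢ (e , c) →
    ∀ {x} → x ∈ map proj₁ L → x ∈ map proj₁ (remove L (e , c))
  enlarge b∈ b≢c x∈ with _ , d∈ , refl ← ∈-map⁻ proj₁ x∈ = remove-covers b∈ b≢c d∈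

  -- A leaf in a copy other than `e₀` automatically differs from the prescribed block. Only if all
  -- blocks lie in the copy `e₀` is `b₀` itself prescribed inside that copy.
  at⁺-acyclic : Acyclic at⁺ (suc ℓ)
  at⁺-acyclic L L≤ (e₀ , b₀) (e₁ , b₁) b₀∈ b₁∈ b₁≢b₀ with any∈? (λ d → ¬? (proj₁ d ≟H e₀)) L
  ... | no all-e₀ with e₁ ≟H e₀
  ...   | no e₁≢e₀ = contradiction ((e₁ , b₁) , b₁∈ , e₁≢e₀) all-e₀
  ...   | yes refl =
    let b , b≢ , b∈ , leaf = copy-leaf L L≤ e₀ b₀ b₁ b₀∈ b₁∈ (λ { refl → b₁≢b₀ refl })
          λ { x (d , d∈ , d≢ , _) _ → contradiction (d , d∈ , d≢) all-e₀ }
    in (e₀ , b) , b∈ , (b≢ ∘ cong proj₂) , leaf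
  at⁺-acyclic L L≤ (e₀ , b₀) _ b₀∈ _ _ | yes ((e , b) , b∈ , e≢e₀)
    with any∈? (λ d → ¬? (proj₁ d ≟H e₀) ×-dec ¬? (twin? L d)) L
  ... | yes ((e′ , b′) , b′∈ , e′≢e₀ , alone) = (e′ , b′) , b′∈ , (e′≢e₀ ∘ cong proj₁) ,
    single-leaf L e′ b′ λ {c} c∈ → decidable-stable (c ≟P b′)
      λ c≢ → alone ((e′ , c) , c∈ , refl , λ { refl → c≢ refl })
  ... | no none-alone
    -- Every block outside the copy `e₀` has a twin in its copy. Dropping one from the copy `e`
    -- leaves few enough entries for `H` to provide a leaf `e′`, whose copy again contains two
    -- blocks.
    with (_ , c) , c∈ , refl , c≢ ← twins none-alone b∈ e≢e₀
    with e′ , e′∈ , e′≢e₀ , leafH ← H-acyclic (map proj₁ (remove L (e , c)))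
           (s≤s⁻¹ (≤-trans (remove-shortens c∈) L≤)) e₀ e
           (remove-covers b∈ (c≢ ∘ ≡-sym) b₀∈) (remove-covers b∈ (c≢ ∘ ≡-sym) b∈) e≢e₀
    with (_ , b′) , b′∈⁻ , refl ← ∈-map⁻ proj₁ e′∈
    with b′∈ ← proj₁ (∈-filter⁻ (λ d → ¬? (d ≟⁺ (e , c))) {xs = L} b′∈⁻)
    with (_ , c′) , c′∈ , refl , c′≢ ← twins none-alone b′∈ e′≢e₀
    with b″ , b″∈ , leaf ← H-leaf-case L L≤ e′
           (λ x y (ex , d , d∈ , d≢ , dx) (ey , f , f∈ , f≢ , fy) →
              leafH x y (ex , d , enlarge b∈ (c≢ ∘ ≡-sym) d∈ , d≢ , dx)
                (ey , f , enlarge b∈ (c≢ ∘ ≡-sym) f∈ , f≢ , fy))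
           b′ c′ b′∈ c′∈ (λ { refl → c′≢ refl }) =
    (e′ , b″) , b″∈ , (e′≢e₀ ∘ cong proj₁) , leaf

-- Induction on `ℓ`. The construction starts from disjoint copies of the blocks of `T`, labelled by
-- the points of `T`, so that a colouring depending on labels only is a colouring of `T`.
sparse-hypergraph : ∀ ℓ s {U} → Finite U → Σ (Hypergraph U) λ H → Acyclic (at H) ℓ × Chromatic> H s
sparse-hypergraph zero s finU = let H , chromatic = chromatic-hypergraph s finU in
  H , (λ { (_ ∷ _) () _ _ _ _ _ ; [] _ _ _ () _ _ }) , chromatic
sparse-hypergraph (suc ℓ) s {U} finU = hyp X′ , acyclic X′ , chromatic′
  where
  T = proj₁ (chromatic-hypergraph s finU)
  a = ∣ finitePoint T ∣

  P⁰ : PartiteHypergraph U a (suc ℓ)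
  P⁰ = record
    { hyp = record
      -- The isolated points `inj₁ x` represent the labels; the colouring of `T` is read off from
      -- them.
      { Point = Point T ⊎ (Block T × U)
      ; Block = Block T
      ; finitePoint = finite-⊎ (finitePoint T) (finite-× (finiteBlock T) finU)
      ; finiteBlock = finiteBlock T
      ; at = λ b u → inj₂ (b , u)
      ; at-inj = λ { _ _ _ refl → refl } }
    ; lab = λ { (inj₁ x) → encode (finitePoint T) x ; (inj₂ (b , u)) → encode (finitePoint T) (at T b u) }
    ; transversal = λ b u v eq → at-inj T b u v (encode-injective (finitePoint T) eq)
    ; acyclic = λ { L _ b₀ b₁ _ b₁∈ b₁≢ → b₁ , b₁∈ , b₁≢ ,
        λ { x y ((_ , refl) , b , _ , b≢ , (_ , refl)) _ → contradiction refl b≢ } } }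

  Bad : ∀ (X : PartiteHypergraph U a (suc ℓ)) → (Point (hyp X) → Fin s) → Set
  Bad X = Monochromatic (hyp X)

  step : ∀ X i → ∃ (Step (λ X → Point (hyp X)) lab Bad X i)
  -- The induction hypothesis is applied with blocks as large as the current point set, hence the
  -- generality in `U`.
  step X i with H , H-acyclic , chromatic ← sparse-hypergraph ℓ s (finitePoint (hyp X)) = X′ , embed
    where
    open AmalgamAcyclic X i H H-acyclic finU
    X′ : PartiteHypergraph U a (suc ℓ)
    X′ = record
      { hyp = record
        { finitePoint = finiteGlued (finitePoint (hyp X))
        ; finiteBlock = finite-× (finiteBlock H) (finiteBlock (hyp X))
        ; at = at⁺ ; at-inj = at⁺-inj }
      ; lab = label
      ; transversal = λ (e , b) u v eq → transversal X b u v
          (trans (≡-sym (label-copy e _)) (trans eq (label-copy e _)))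
      ; acyclic = at⁺-acyclic }
    embed : Step (λ X → Point (hyp X)) lab Bad X i X′
    embed c with e , mono ← copy-mono chromatic c =
      copy e , label-copy e , mono , λ (b , mono-b) → (e , b) , mono-b

  bad⁰ : ∀ c → ConstantBelow (lab P⁰) a c → Bad P⁰ c
  bad⁰ c const = let b , mono = proj₂ (chromatic-hypergraph s finU) (c ∘ inj₁) in
    b , λ u v → trans (on-block b u) (trans (mono u v) (≡-sym (on-block b v)))
    where
    on-block : ∀ b u → c (inj₂ (b , u)) ≡ c (inj₁ (at T b u))
    on-block b u = const _ _ refl (toℕ<n _)

  result = iterate-step (λ X → Point (hyp X)) lab Bad step ≤-refl P⁰ bad⁰
  X′ = proj₁ result
  chromatic′ = proj₂ result

-- Edge-coloured graphs: pullbacks and amalgamation over a vertex.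

ColHom : ∀ {r} → ECGraph r → ECGraph r → Set
ColHom X Y = Σ (V (graph X) → V (graph Y)) λ h → IsHom (graph X) (graph Y) h ×
  (∀ u v → Adj (graph X) u v → col Y (h u) (h v) ≡ col X u v)

EFree-reflect : ∀ {r} {ℰ : List (ECGraph r)} {X Y} → ColHom X Y → EFree ℰ Y → EFree ℰ X
EFree-reflect (t , t-hom , t-col) free E E∈ (h , h-hom , h-col) = free E E∈
  ( t ∘ h , (λ u v uv → t-hom _ _ (h-hom u v uv))
  , λ u v uv → trans (t-col _ _ (h-hom u v uv)) (h-col u v uv))

-- A blow-up of the subgraph induced on the image of `f`: vertices with the same image are
-- non-adjacent twins.
pullback : ∀ {m} (G : Graph) → (Fin m → V G) → Graph
pullback {m} G f = record
  { n = m ; adj = λ x y → adj G (f x) (f y)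
  ; sym = λ x y → sym G (f x) (f y) ; irrefl = λ x → irrefl G (f x) }

factorise : ∀ {m k} (f : Fin m → Fin k) → ∃ λ l → l ≤ m × Σ (Fin m → Fin l) λ q → Σ (Fin l → Fin k) λ ι →
  Injective ι × (∀ x → ι (q x) ≡ f x)
factorise {zero} f = 0 , z≤n , (λ ()) , (λ ()) , (λ ()) , λ ()
factorise {suc m} f with l , l≤m , q , ι , ι-inj , eq ← factorise (f ∘ suc) | Finₚ.any? (λ j → ι j Fin.≟ f zero)
... | yes (j , ιj≡f0) = l , ℕₚ.m≤n⇒m≤1+n l≤m , j VecF.∷ q , ι , ι-inj , λ { zero → ιj≡f0 ; (suc x) → eq x }
... | no f0∉ι = suc l , s≤s l≤m , zero VecF.∷ (suc ∘ q) , f zero VecF.∷ ι , inj , λ { zero → refl ; (suc x) → eq x }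
  where
  inj : Injective (f zero VecF.∷ ι)
  inj zero    zero    _  = refl
  inj zero    (suc y) e  = contradiction (y , ≡-sym e) f0∉ι
  inj (suc x) zero    e  = contradiction (x , e) f0∉ι
  inj (suc x) (suc y) e  = cong suc (ι-inj x y e)

-- The image of `f` induces a subgraph on at most `K` vertices, and its ℰ-free colouring is pulled
-- back along `q`.
pullback-ColE : ∀ {r} {ℰ : List (ECGraph r)} {G K} → (∀ H → IsSubgraph H G → n H ≤ K → ColE ℰ H) →
  ∀ {m} → m ≤ K → (f : Fin m → V G) → ColE ℰ (pullback G f)
pullback-ColE {ℰ = ℰ} {G} locally m≤K f
  with l , l≤m , q , ι , ι-inj , eq ← factorise f
  with γ , γ-sym , free ← locally (pullback G ι) (ι , ι-inj , λ _ _ uv → uv) (≤-trans l≤m m≤K) =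
  (λ x y → γ (q x) (q y)) , (λ x y xy → γ-sym _ _ (q-hom x y xy)) ,
  EFree-reflect
    {X = record { graph = pullback G f ; col = λ x y → γ (q x) (q y)
                ; col-sym = λ x y xy → γ-sym (q x) (q y) (q-hom x y xy) }}
    {Y = record { graph = pullback G ι ; col = γ ; col-sym = γ-sym }} (q , q-hom , λ _ _ _ → refl) free
  where
  q-hom : IsHom (pullback G f) (pullback G ι) q
  q-hom x y xy = trans (cong₂ (adj G) (eq x) (eq y)) xy

encodeGraph : ∀ {r W} → Finite W → (A : W → W → Bool) → (∀ u v → A u v ≡ A v u) → (∀ u → A u u ≡ false) →
  (c : W → W → Fin r) → (∀ u v → A u v ≡ true → c u v ≡ c v u) → ECGraph r
encodeGraph fin A A-sym A-irrefl c c-sym = record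
  { graph = record
    { n = ∣ fin ∣ ; adj = λ a b → A (decode fin a) (decode fin b)
    ; sym = λ _ _ → A-sym _ _ ; irrefl = λ _ → A-irrefl _ }
  ; col = λ a b → c (decode fin a) (decode fin b)
  ; col-sym = λ _ _ → c-sym _ _ }

delete : ∀ {k} (v : Fin k) → ∃ λ m → Σ (Fin m → Fin k) λ skip →
  Injective skip × (∀ j → skip j ≢ v) × (∀ y → y ≡ v ⊎ ∃ λ j → y ≡ skip j)
delete {suc m} v = m , punchIn v , Finₚ.punchIn-injective v , Finₚ.punchInᵢ≢i v , split
  where
  split : ∀ y → y ≡ v ⊎ ∃ λ j → y ≡ punchIn v j
  split y with v Fin.≟ y
  ... | yes v≡y = inj₁ (≡-sym v≡y)
  ... | no v≢y  = inj₂ (punchOut v≢y , ≡-sym (Finₚ.punchIn-punchOut v≢y))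

∧-true : ∀ {x y} → x ∧ y ≡ true → x ≡ true × y ≡ true
∧-true {true} {true} _ = refl , refl

does-true : ∀ {A : Set} (A? : Dec A) → does A? ≡ true → A
does-true (yes a) _ = a

-- The vertex `v₂` is deleted from `G₂`, and `v₁` takes over its neighbours.
amalgam : ∀ {r} (G₁ G₂ : ECGraph r) v₁ v₂ → ∃ λ G → IsAmalgam G₁ G₂ G v₁ v₂
amalgam {r} G₁ G₂ v₁ v₂ with m , skip , skip-inj , skip≢ , split ← delete v₂ = G , record
  { f₁ = enc ∘ inj₁
  ; f₂ = enc ∘ g₂
  ; f₁-inj = λ x y eq → inj₁-injective (encode-injective fin eq)
  ; f₂-inj = λ x y eq → g₂-inj x y (encode-injective fin eq)
  ; glue = cong enc (≡-sym g₂-v₂)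
  ; meet = λ x y eq → g₂-meet x y (encode-injective fin eq)
  ; cover = λ w → cover′ w (dec w) refl
  ; adj₁ = λ x y → ⇔-≡ (A-enc (inj₁ x) (inj₁ y))
  ; adj₂ = λ x y → ⇔-≡ (trans (A-enc (g₂ x) (g₂ y)) (A-g₂ x y))
  ; edges = λ a b ab → edges′ a b (dec a) (dec b) refl refl ab
  ; col₁ = λ x y _ → C-enc (inj₁ x) (inj₁ y)
  ; col₂ = λ x y xy → trans (C-enc (g₂ x) (g₂ y)) (C-g₂ x y xy)
  }
  where
  W = V (graph G₁) ⊎ Fin m
  fin : Finite W
  fin = finite-⊎ finite-Fin finite-Fin
  enc = encode fin
  dec = decode fin
  A₁ = adj (graph G₁)
  A₂ = adj (graph G₂)
  A : W → W → Bool
  A (inj₁ x) (inj₁ y) = A₁ x y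
  A (inj₁ x) (inj₂ j) = does (x Fin.≟ v₁) ∧ A₂ v₂ (skip j)
  A (inj₂ i) (inj₁ y) = does (y Fin.≟ v₁) ∧ A₂ (skip i) v₂
  A (inj₂ i) (inj₂ j) = A₂ (skip i) (skip j)
  C : W → W → Fin r
  C (inj₁ x) (inj₁ y) = col G₁ x y
  C (inj₁ x) (inj₂ j) = col G₂ v₂ (skip j)
  C (inj₂ i) (inj₁ y) = col G₂ (skip i) v₂
  C (inj₂ i) (inj₂ j) = col G₂ (skip i) (skip j)
  A-sym : ∀ u v → A u v ≡ A v u
  A-sym (inj₁ x) (inj₁ y) = sym (graph G₁) x y
  A-sym (inj₁ x) (inj₂ j) = cong (does (x Fin.≟ v₁) ∧_) (sym (graph G₂) _ _)
  A-sym (inj₂ i) (inj₁ y) = cong (does (y Fin.≟ v₁) ∧_) (sym (graph G₂) _ _)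
  A-sym (inj₂ i) (inj₂ j) = sym (graph G₂) _ _
  A-irrefl : ∀ u → A u u ≡ false
  A-irrefl (inj₁ x) = irrefl (graph G₁) x
  A-irrefl (inj₂ j) = irrefl (graph G₂) (skip j)
  C-sym : ∀ u v → A u v ≡ true → C u v ≡ C v u
  C-sym (inj₁ x) (inj₁ y) uv = col-sym G₁ x y uv
  C-sym (inj₁ x) (inj₂ j) uv = col-sym G₂ _ _ (proj₂ (∧-true uv))
  C-sym (inj₂ i) (inj₁ y) uv = col-sym G₂ _ _ (proj₂ (∧-true uv))
  C-sym (inj₂ i) (inj₂ j) uv = col-sym G₂ _ _ uv
  G : ECGraph r
  G = encodeGraph fin A A-sym A-irrefl C C-sym
  g₂ : V (graph G₂) → W
  g₂ y with split y
  ... | inj₁ _       = inj₁ v₁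
  ... | inj₂ (j , _) = inj₂ j
  g₂-v₂ : g₂ v₂ ≡ inj₁ v₁
  g₂-v₂ with split v₂
  ... | inj₁ _        = refl
  ... | inj₂ (j , eq) = contradiction (≡-sym eq) (skip≢ j)
  g₂-skip : ∀ j → g₂ (skip j) ≡ inj₂ j
  g₂-skip j with split (skip j)
  ... | inj₁ eq        = contradiction eq (skip≢ j)
  ... | inj₂ (j′ , eq) = cong inj₂ (≡-sym (skip-inj j j′ eq))
  g₂-inj : Injective g₂
  g₂-inj x y eq with split x | split y
  ... | inj₁ refl       | inj₁ refl       = refl
  ... | inj₂ (j , refl) | inj₂ (j′ , refl) = cong skip (inj₂-injective eq)
  ... | inj₁ _ | inj₂ _ = contradiction eq λ ()
  ... | inj₂ _ | inj₁ _ = contradiction eq λ ()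
  g₂-meet : ∀ x y → inj₁ x ≡ g₂ y → x ≡ v₁ × y ≡ v₂
  g₂-meet x y eq with split y
  ... | inj₁ y≡v₂ = inj₁-injective eq , y≡v₂
  ... | inj₂ _    = contradiction eq λ ()
  A-g₂ : ∀ x y → A (g₂ x) (g₂ y) ≡ A₂ x y
  A-g₂ x y with split x | split y
  ... | inj₁ refl       | inj₁ refl       = trans (irrefl (graph G₁) v₁) (≡-sym (irrefl (graph G₂) v₂))
  ... | inj₁ refl       | inj₂ (j , refl) = cong (_∧ A₂ v₂ (skip j)) (dec-true (v₁ Fin.≟ v₁) refl)
  ... | inj₂ (i , refl) | inj₁ refl       = cong (_∧ A₂ (skip i) v₂) (dec-true (v₁ Fin.≟ v₁) refl)
  ... | inj₂ (i , refl) | inj₂ (j , refl) = refl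
  C-g₂ : ∀ x y → A₂ x y ≡ true → C (g₂ x) (g₂ y) ≡ col G₂ x y
  C-g₂ x y xy with split x | split y
  ... | inj₁ refl       | inj₁ refl       = contradiction (trans (≡-sym xy) (irrefl (graph G₂) v₂)) λ ()
  ... | inj₁ refl       | inj₂ (j , refl) = refl
  ... | inj₂ (i , refl) | inj₁ refl       = refl
  ... | inj₂ (i , refl) | inj₂ (j , refl) = refl
  A-enc : ∀ u v → A (dec (enc u)) (dec (enc v)) ≡ A u v
  A-enc u v = cong₂ A (decode-encode fin u) (decode-encode fin v)
  C-enc : ∀ u v → C (dec (enc u)) (dec (enc v)) ≡ C u v
  C-enc u v = cong₂ C (decode-encode fin u) (decode-encode fin v)
  ⇔-≡ : ∀ {b b′ : Bool} → b ≡ b′ → (b ≡ true) ⇔ (b′ ≡ true)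
  ⇔-≡ eq = mk⇔ (trans (≡-sym eq)) (trans eq)
  at-enc : ∀ {a u w} → dec a ≡ w → u ≡ w → enc u ≡ a
  at-enc {a} eq refl = trans (cong enc (≡-sym eq)) (encode-decode fin a)
  cover′ : ∀ a w → dec a ≡ w → (∃ λ x → enc (inj₁ x) ≡ a) ⊎ (∃ λ y → enc (g₂ y) ≡ a)
  cover′ a (inj₁ x) eq = inj₁ (x , at-enc eq refl)
  cover′ a (inj₂ j) eq = inj₂ (skip j , at-enc eq (g₂-skip j))
  edges′ : ∀ a b u v → dec a ≡ u → dec b ≡ v → A (dec a) (dec b) ≡ true →
    (∃ λ x → ∃ λ y → enc (inj₁ x) ≡ a × enc (inj₁ y) ≡ b) ⊎
    (∃ λ x → ∃ λ y → enc (g₂ x) ≡ a × enc (g₂ y) ≡ b)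
  edges′ a b (inj₁ x) (inj₁ y) ea eb _ = inj₁ (x , y , at-enc ea refl , at-enc eb refl)
  edges′ a b (inj₂ i) (inj₂ j) ea eb _ = inj₂ (skip i , skip j , at-enc ea (g₂-skip i) , at-enc eb (g₂-skip j))
  edges′ a b (inj₁ x) (inj₂ j) ea eb ab with
    refl ← does-true (x Fin.≟ v₁) (proj₁ (∧-true (trans (≡-sym (cong₂ A ea eb)) ab))) =
    inj₂ (v₂ , skip j , at-enc ea g₂-v₂ , at-enc eb (g₂-skip j))
  edges′ a b (inj₂ i) (inj₁ y) ea eb ab with
    refl ← does-true (y Fin.≟ v₁) (proj₁ (∧-true (trans (≡-sym (cong₂ A ea eb)) ab))) =
    inj₂ (skip i , v₂ , at-enc ea (g₂-skip i) , at-enc eb g₂-v₂)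

amalgam-EFree : ∀ {r} {ℰ : List (ECGraph r)} → AmalgamationClosed ℰ → ∀ G₁ G₂ v₁ v₂ → EFree ℰ G₁ → EFree ℰ G₂ →
  ∃ λ G → EFree ℰ G × Σ (ColHom G₁ G) λ h₁ → Σ (ColHom G₂ G) λ h₂ → proj₁ h₁ v₁ ≡ proj₁ h₂ v₂
amalgam-EFree closed G₁ G₂ v₁ v₂ free₁ free₂ with G , is ← amalgam G₁ G₂ v₁ v₂ =
  G , closed G₁ G₂ G v₁ v₂ free₁ free₂ is ,
  (f₁ , (λ x y → Equivalence.from (adj₁ x y)) , col₁) ,
  (f₂ , (λ x y → Equivalence.from (adj₂ x y)) , col₂) , glue
  where open IsAmalgam is

-- Unions of edge-coloured graphs along hyperforests.

module Covered {r} {ℰ : List (ECGraph r)} (closed : AmalgamationClosed ℰ)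
  {B : Set} (_≟_ : DecidableEquality B)
  {X : Set} (P : B → ECGraph r) (κ : ∀ e → V (graph (P e)) → X) (κ-inj : ∀ e → Injective (κ e))
  (_≟X_ : DecidableEquality X)
  (free : ∀ e → EFree ℰ (P e)) (vertex : ∀ e → V (graph (P e))) (e₀ : B)
  {ℓ : ℕ} (acyclic : Acyclic κ ℓ) where

  -- Certifies that the copies in `L` together map into an ℰ-free graph, which suffices because
  -- homomorphisms reflect ℰ-freeness. Away from these copies `t` is arbitrary.
  record Development (L : List B) : Set where
    field
      target      : ECGraph r
      target-free : EFree ℰ target
      base        : V (graph target)
      t           : X → V (graph target)
      t-hom       : ∀ e → e ∈ L → ∀ u v → Adj (graph (P e)) u v →
        Adj (graph target) (t (κ e u)) (t (κ e v)) × col target (t (κ e u)) (t (κ e v)) ≡ col (P e) u v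
  open Development

  others : B → List B → List B
  others b = filter (λ e → ¬? (e ≟ b))

  leaf-exists : ∀ e L → length (e ∷ L) ≤ ℓ → ∃ λ b → b ∈ e ∷ L × Leaf κ (e ∷ L) b
  leaf-exists e L L≤ with any∈? (λ e′ → ¬? (e′ ≟ e)) (e ∷ L)
  ... | yes (e′ , e′∈ , e′≢e) = let b , b∈ , _ , leaf = acyclic (e ∷ L) L≤ e e′ (here refl) e′∈ e′≢e in b , b∈ , leaf
  ... | no all-e = e , here refl , λ { x y (_ , b , b∈ , b≢ , _) _ → contradiction (b , b∈ , b≢) all-e }

  -- Development maps need not be injective, so the target may be glued to a
  -- disjoint copy at arbitrary vertices.
  attachment : ∀ {L b} → Leaf κ L b → (D : Development (others b L)) →
    ∃ λ v₁ → ∃ λ v₂ → ∀ u e w → e ∈ L → e ≢ b → κ b u ≡ κ e w → t D (κ e w) ≡ v₁ × u ≡ v₂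
  attachment {L} {b} leaf D with any∈? (λ e → ¬? (e ≟ b) ×-dec
    Finₚ.any? λ u → Finₚ.any? λ w → κ b u ≟X κ e w) L
  ... | no ¬shared = base D , vertex b , λ u e w e∈ e≢ eq → contradiction (e , e∈ , e≢ , u , w , eq) ¬shared
  ... | yes (e′ , e′∈ , e′≢ , u′ , w′ , eq′) = t D (κ e′ w′) , u′ , λ u e w e∈ e≢ eq →
    let same = leaf (κ b u) (κ b u′) ((u , refl) , e , e∈ , e≢ , w , ≡-sym eq)
                 ((u′ , refl) , e′ , e′∈ , e′≢ , w′ , ≡-sym eq′)
    in cong (t D) (trans (≡-sym eq) (trans same eq′)) , κ-inj b u u′ same

  -- The leaf `b` meets the other copies in at most one vertex. Amalgamating `P b` with the target
  -- there makes the two maps agree on that vertex.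
  attach : ∀ {L b} → Leaf κ L b → Development (others b L) → Development L
  attach {L} {b} leaf D with v₁ , v₂ , att ← attachment leaf D
    with T , T-free , (f₁ , f₁-hom , f₁-col) , (f₂ , f₂-hom , f₂-col) , glue ←
      amalgam-EFree closed (target D) (P b) v₁ v₂ (target-free D) (free b) = record
    { target = T ; target-free = T-free ; base = f₁ v₁ ; t = t⁺ ; t-hom = hom }
    where
    t⁺ : X → V (graph T)
    t⁺ x with Finₚ.any? (λ u → κ b u ≟X x)
    ... | yes (u , _) = f₂ u
    ... | no _        = f₁ (t D x)
    t⁺-b : ∀ u → t⁺ (κ b u) ≡ f₂ u
    t⁺-b u with Finₚ.any? (λ u′ → κ b u′ ≟X κ b u)
    ... | yes (u′ , eq) = cong f₂ (κ-inj b u′ u eq)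
    ... | no ∄u         = contradiction (u , refl) ∄u
    t⁺-e : ∀ e → e ∈ L → e ≢ b → ∀ w → t⁺ (κ e w) ≡ f₁ (t D (κ e w))
    t⁺-e e e∈ e≢b w with Finₚ.any? (λ u → κ b u ≟X κ e w)
    ... | no _         = refl
    ... | yes (u , eq) = let eq₁ , eq₂ = att u e w e∈ e≢b eq in
      trans (cong f₂ eq₂) (trans (≡-sym glue) (cong f₁ (≡-sym eq₁)))
    hom : ∀ e → e ∈ L → ∀ u v → Adj (graph (P e)) u v →
      Adj (graph T) (t⁺ (κ e u)) (t⁺ (κ e v)) × col T (t⁺ (κ e u)) (t⁺ (κ e v)) ≡ col (P e) u v
    hom e e∈ u v uv with e ≟ b
    ... | yes refl rewrite t⁺-b u | t⁺-b v = f₂-hom u v uv , f₂-col u v uv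
    ... | no e≢b rewrite t⁺-e e e∈ e≢b u | t⁺-e e e∈ e≢b v =
      let adj′ , col′ = t-hom D e (∈-filter⁺ (λ e′ → ¬? (e′ ≟ b)) e∈ e≢b) u v uv
      in f₁-hom _ _ adj′ , trans (f₁-col _ _ adj′) col′

  -- Leaves are split off until no copy is left. The bound `k` makes the recursion structural, since
  -- `others` drops every occurrence of the leaf.
  develop : ∀ k L → length L ≤ k → length L ≤ ℓ → Development L
  develop k [] _ _ = record
    { target = P e₀ ; target-free = free e₀ ; base = vertex e₀ ; t = λ _ → vertex e₀ ; t-hom = λ _ () }
  develop (suc k) (e ∷ L) L≤k L≤ℓ with b , b∈ , leaf ← leaf-exists e L L≤ℓ =
    attach leaf (develop k (others b (e ∷ L)) (s≤s⁻¹ (≤-trans shorter L≤k)) (≤-trans (ℕₚ.<⇒≤ shorter) L≤ℓ))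
    where
    shorter = filter-notAll (λ e′ → ¬? (e′ ≟ b)) (e ∷ L) (lose b∈ λ b≢b → b≢b refl)

  Edge : X → X → Set
  Edge x y = ∃ λ e → ∃ λ u → ∃ λ v → κ e u ≡ x × κ e v ≡ y × Adj (graph (P e)) u v

  Edge-sym : ∀ {x y} → Edge x y → Edge y x
  Edge-sym (e , u , v , eu , ev , uv) = e , v , u , ev , eu , trans (sym (graph (P e)) v u) uv

  Edge-irrefl : ∀ {x} → ¬ Edge x x
  Edge-irrefl (e , u , v , eu , ev , uv) with refl ← κ-inj e u v (trans eu (≡-sym ev)) =
    contradiction (trans (≡-sym uv) (irrefl (graph (P e)) u)) λ ()

  Covers : (Q : ECGraph r) → (V (graph Q) → X) → Set
  Covers Q ψ = ∀ a b → Adj (graph Q) a b →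
    Σ (Edge (ψ a) (ψ b)) λ (e , u , v , _) → col Q a b ≡ col (P e) u v

  -- Picking a copy for each edge of a forbidden `E` mapped to `Q` gives at most `ℓ` copies, counted
  -- by ordered pairs of vertices. Their development would carry `E` into an ℰ-free graph.
  covered-EFree : (∀ E → E ∈ ℰ → n (graph E) * n (graph E) ≤ ℓ) → ∀ Q ψ → Covers Q ψ → EFree ℰ Q
  covered-EFree bound Q ψ covers E E∈ (h , h-hom , h-col) =
    target-free D E E∈ (t D ∘ ψ ∘ h , (λ u v uv → proj₁ (image u v uv)) , λ u v uv → proj₂ (image u v uv))
    where
    VE = V (graph E)
    pick : VE × VE → B
    pick (u , v) with adj (graph E) u v Bool.≟ true
    ... | yes uv = proj₁ (proj₁ (covers (h u) (h v) (h-hom u v uv)))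
    -- A default for non-adjacent pairs, so that all pairs can be tabulated.
    ... | no _   = e₀
    picks : List B
    picks = tabulate (pick ∘ remQuot (n (graph E)))
    length-picks : length picks ≤ ℓ
    length-picks rewrite length-tabulate (pick ∘ remQuot (n (graph E))) = bound E E∈
    picked : ∀ u v → pick (u , v) ∈ picks
    picked u v = subst (_∈ picks) (cong pick (Finₚ.remQuot-combine u v)) (∈-tabulate⁺ (combine u v))
    D : Development picks
    D = develop _ _ ≤-refl length-picks
    image : ∀ u v → Adj (graph E) u v → Adj (graph (target D)) (t D (ψ (h u))) (t D (ψ (h v))) ×
      col (target D) (t D (ψ (h u))) (t D (ψ (h v))) ≡ col E u v
    image u v uv with adj (graph E) u v Bool.≟ true
       | picked u v
    ... | no ¬uv | _  = contradiction uv ¬uv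
    ... | yes uv | e∈ with covers (h u) (h v) (h-hom u v uv)
    ... | (e , x , y , ex , ey , xy) , same =
      let adj′ , col′ = t-hom D e e∈ x y xy in
      subst (λ (a , b) → Adj (graph (target D)) (t D a) (t D b) × col (target D) (t D a) (t D b) ≡ col E u v)
        (cong₂ _,_ ex ey) (adj′ , trans col′ (trans (≡-sym same) (h-col u v uv)))

  module Union (finB : Finite B) (finX : Finite X) where

    edge? : ∀ x y → Dec (Edge x y)
    edge? x y = finite-any? finB λ e → Finₚ.any? λ u → Finₚ.any? λ v →
      (κ e u ≟X x) ×-dec (κ e v ≟X y) ×-dec (adj (graph (P e)) u v Bool.≟ true)

    -- Distinct copies may disagree on a common edge; any symmetric choice will do.
    choice : ∀ {x y} → Dec (Edge x y) → Fin r
    choice (yes (e , u , v , _)) = col (P e) u v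
    choice (no _)                = col (P e₀) (vertex e₀) (vertex e₀)

    colour : X → X → Fin r
    colour x y with encode finX x Fin.≤? encode finX y
    ... | yes _ = choice (edge? x y)
    ... | no _  = choice (edge? y x)

    colour-sym : ∀ x y → colour x y ≡ colour y x
    colour-sym x y with encode finX x Fin.≤? encode finX y | encode finX y Fin.≤? encode finX x
    ... | yes _   | no _    = refl
    ... | no _    | yes _   = refl
    ... | no x≰y  | no y≰x  = contradiction (ℕₚ.<⇒≤ (ℕₚ.≰⇒> x≰y)) y≰x
    ... | yes x≤y | yes y≤x with refl ← encode-injective finX (Finₚ.≤-antisym x≤y y≤x) = refl

    colour-edge : ∀ x y → Edge x y → Σ (Edge x y) λ (e , u , v , _) → colour x y ≡ col (P e) u v
    colour-edge x y xy with encode finX x Fin.≤? encode finX y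
    ... | yes _ with edge? x y
    ...   | yes edge = edge , refl
    ...   | no ¬xy   = contradiction xy ¬xy
    colour-edge x y xy | no _ with edge? y x
    ...   | yes edge@(e , u , v , _ , _ , uv) = Edge-sym edge , col-sym (P e) u v uv
    ...   | no ¬yx   = contradiction (Edge-sym xy) ¬yx

    union : ECGraph r
    union = encodeGraph finX (λ x y → does (edge? x y))
      (λ x y → does-⇔ (mk⇔ Edge-sym Edge-sym) (edge? x y) (edge? y x))
      (λ x → dec-false (edge? x x) Edge-irrefl)
      colour (λ x y _ → colour-sym x y)

    union-covers : Covers union (decode finX)
    union-covers a b ab = colour-edge _ _ (does-true (edge? _ _) ab)

    union-hom : ∀ e → IsHom (graph (P e)) (graph union) (encode finX ∘ κ e)
    union-hom e u v uv = dec-true (edge? _ _)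
      (e , u , v , ≡-sym (decode-encode finX _) , ≡-sym (decode-encode finX _) , uv)

-- The partite construction for graphs and the contradiction.

≤-max : ∀ {A : Set} (f : A → ℕ) {x xs} → x ∈ xs → f x ≤ max 0 (map f xs)
≤-max f {xs = xs} x∈ = All.lookup (xs≤max 0 (map f xs)) (∈-map⁺ f x∈)

extend : ∀ {A : Set} {m k} (m≤k : m ≤ k) → A → (h : Fin m → A) →
  Σ (Fin k → A) λ f → ∀ u → f (inject≤ u m≤k) ≡ h u
extend {A} {m} {k} m≤k a h = f , f-inject
  where
  f : Fin k → A
  f i with toℕ i ℕₚ.<? m
  ... | yes i<m = h (fromℕ< i<m)
  ... | no _    = a
  f-inject : ∀ u → f (inject≤ u m≤k) ≡ h u
  f-inject u with toℕ (inject≤ u m≤k) ℕₚ.<? m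
  ... | yes i<m = cong h (toℕ-injective (trans (toℕ-fromℕ< i<m) (Finₚ.toℕ-inject≤ u m≤k)))
  ... | no i≮m  = contradiction (subst (_< m) (≡-sym (Finₚ.toℕ-inject≤ u m≤k)) (toℕ<n u)) i≮m

vertex? : ∀ G → V G ⊎ n G ≡ 0
vertex? G with n G
... | zero  = inj₂ refl
... | suc _ = inj₁ zero

FFree : ∀ {s} → List (VCGraph s) → (G : Graph) → (V G → Fin s) → Set
FFree {s} ℱ G c = ∀ (Fφ : VCGraph s) → Fφ ∈ ℱ →
  ¬ (Σ (V (vgraph Fφ) → V G) λ h → IsHom (vgraph Fφ) G h × (∀ u → c (h u) ≡ vcol Fφ u))

FFree-∘ : ∀ {s} {ℱ : List (VCGraph s)} G G′ κ c → IsHom G G′ κ → FFree ℱ G′ c → FFree ℱ G (c ∘ κ)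
FFree-∘ _ _ κ _ κ-hom free Fφ F∈ (h , h-hom , h-col) =
  free Fφ F∈ (κ ∘ h , (λ u v uv → κ-hom _ _ (h-hom u v uv)) , h-col)

record PartiteGraph {r} (ℰ : List (ECGraph r)) (a : ℕ) : Set where
  field
    ecgraph : ECGraph r
    efree   : EFree ℰ ecgraph
    vertex  : V (graph ecgraph)
    plab    : V (graph ecgraph) → Fin a

  Vertex : Set
  Vertex = V (graph ecgraph)
open PartiteGraph

theorem4 : (r : ℕ) (ℰ : List (ECGraph r)) →
    AmalgamationClosed ℰ → NotLocallyDetermined ℰ →
    ¬ (Σ ℕ λ s → Σ (List (VCGraph s)) λ ℱ →
    (G : Graph) → ColF ℱ G ⇔ ColE ℰ G)
theorem4 r ℰ closed notLocal (s , ℱ , equivalent) =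
  -- The final graph is in Col(ℰ), so it has an ℱ-free colouring, but all its colourings are bad.
  let c , c-free = Equivalence.from (equivalent (graph X)) (col X , col-sym X , efree (proj₁ final))
  in proj₂ final c c-free
  where
  ℓ = max 0 (map (λ E → n (graph E) * n (graph E)) ℰ)
  -- The successor makes `K` positive, as (ii) demands, and gives every piece a vertex.
  K = suc (max 0 (map (n ∘ vgraph) ℱ))
  G = proj₁ (notLocal K (s≤s z≤n))
  G∉ColE = proj₁ (proj₂ (notLocal K (s≤s z≤n)))
  locally = proj₂ (proj₂ (notLocal K (s≤s z≤n)))

  bound : ∀ E → E ∈ ℰ → n (graph E) * n (graph E) ≤ ℓ
  bound E E∈ = ≤-max (λ E → n (graph E) * n (graph E)) E∈

  g₀ : V G
  g₀ with vertex? G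
  ... | inj₁ g   = g
  -- An empty `G` would be a subgraph of itself with at most `K` vertices.
  ... | inj₂ n≡0 = contradiction
    (locally G (id , (λ _ _ eq → eq) , λ _ _ uv → uv) (subst (_≤ K) (≡-sym n≡0) z≤n)) G∉ColE

  Bad : (P : PartiteGraph ℰ (n G)) → (Vertex P → Fin s) → Set
  Bad P c = ¬ FFree ℱ (graph (ecgraph P)) c

  step : ∀ P i → ∃ (Step Vertex plab Bad P i)
  -- With the extra colour a colouring exists even if `s` is zero, and so a block `e₀` exists.
  step P i with H , H-acyclic , chromatic ← sparse-hypergraph ℓ (suc s) (finite-Fin {n (graph (ecgraph P))}) =
    P′ , embed
    where
    open PartiteAmalgam Fin._≟_ (plab P) i H
    e₀ = proj₁ (chromatic λ _ → zero)
    fin = finiteGlued finite-Fin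
    open Covered closed (finite-≟ (finiteBlock H)) (λ _ → ecgraph P) copy copy-inj (finite-≟ fin)
      (λ _ → efree P) (λ _ → vertex P) e₀ (copy-acyclic H-acyclic)
    open Union (finiteBlock H) fin
    P′ : PartiteGraph ℰ (n G)
    P′ = record
      { ecgraph = union
      ; efree = covered-EFree bound union (decode fin) union-covers
      ; vertex = encode fin (copy e₀ (vertex P))
      ; plab = label ∘ decode fin }
    embed : Step Vertex plab Bad P i P′
    embed c with e , mono ← copy-mono {s} (λ c → let b , eq = chromatic (inject₁ ∘ c) in
        b , λ u v → Finₚ.inject₁-injective (eq u v)) (c ∘ encode fin) =
      encode fin ∘ copy e , (λ u → trans (cong label (decode-encode fin (copy e u))) (label-copy e u)) ,
      mono , λ bad free → bad (FFree-∘
        (graph (ecgraph P)) (graph union) (encode fin ∘ copy e) c (union-hom e) free)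

  -- Codes of all maps `Fin K → V G`. As these may repeat vertices, smaller graphs of ℱ and
  -- non-injective homomorphisms are accommodated too.
  Index = Fin (n G ^ K)

  piece : Index → ECGraph r
  piece e = let γ , γ-sym , _ = pullback-ColE {G = G} locally ≤-refl (finToFun {n G} {K} e) in
    record { graph = pullback G (finToFun {n G} {K} e) ; col = γ ; col-sym = γ-sym }

  piece-free : ∀ e → EFree ℰ (piece e)
  piece-free e = proj₂ (proj₂ (pullback-ColE {G = G} locally ≤-refl (finToFun {n G} {K} e)))

  -- The isolated vertices `inj₁ x` again represent the labels.
  fin⁰ : Finite (V G ⊎ (Index × Fin K))
  fin⁰ = finite-⊎ finite-Fin (finite-× finite-Fin finite-Fin)

  lab⁰ : V G ⊎ (Index × Fin K) → V G
  lab⁰ (inj₁ x)       = x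
  lab⁰ (inj₂ (e , i)) = finToFun {n G} {K} e i

  κ⁰ : ∀ e → V (graph (piece e)) → V G ⊎ (Index × Fin K)
  κ⁰ e i = inj₂ (e , i)

  κ⁰-inj : ∀ e → Injective (κ⁰ e)
  κ⁰-inj _ _ _ refl = refl

  κ⁰-acyclic : Acyclic κ⁰ ℓ
  κ⁰-acyclic L _ b₀ b₁ _ b₁∈ b₁≢ = b₁ , b₁∈ , b₁≢ ,
    λ { x y ((_ , refl) , b , _ , b≢ , (_ , refl)) _ → contradiction refl b≢ }

  open Covered closed Fin._≟_ piece κ⁰ κ⁰-inj (finite-≟ fin⁰)
    piece-free (λ _ → zero) (funToFin {K} λ _ → g₀) κ⁰-acyclic
  open Union finite-Fin fin⁰

  P⁰ : PartiteGraph ℰ (n G)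
  P⁰ = record
    { ecgraph = union
    ; efree = covered-EFree bound union (decode fin⁰) union-covers
    ; vertex = encode fin⁰ (inj₁ g₀)
    ; plab = lab⁰ ∘ decode fin⁰ }

  -- A homomorphism from a member of ℱ to `G` lifts to the piece indexed by an extension of it to
  -- `Fin K`. The lift preserves labels and hence colours, so an ℱ-free `c` would put `G` into
  -- Col(ℱ).
  bad⁰ : ∀ c → ConstantBelow (plab P⁰) (n G) c → Bad P⁰ c
  bad⁰ c const free = G∉ColE (Equivalence.to (equivalent G) (c ∘ encode fin⁰ ∘ inj₁ , G-free))
    where
    G-free : FFree ℱ G (c ∘ encode fin⁰ ∘ inj₁)
    G-free Fφ F∈ (h , h-hom , h-col) = free Fφ F∈
      ( (λ u → encode fin⁰ (inj₂ (e , ι u)))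
      , (λ u v uv → union-hom e (ι u) (ι v) (trans (cong₂ (adj G) (e-h u) (e-h v)) (h-hom u v uv)))
      , λ u → trans (const _ _ (same-label u) (toℕ<n _)) (h-col u) )
      where
      F≤K = ℕₚ.m≤n⇒m≤1+n (≤-max (n ∘ vgraph) F∈)
      ι : V (vgraph Fφ) → Fin K
      ι u = inject≤ u F≤K
      f = proj₁ (extend F≤K g₀ h)
      e : Index
      e = funToFin f
      e-h : ∀ u → finToFun {n G} {K} e (ι u) ≡ h u
      e-h u = trans (finToFun-funToFin f (ι u)) (proj₂ (extend F≤K g₀ h) u)
      same-label : ∀ u → plab P⁰ (encode fin⁰ (inj₂ (e , ι u))) ≡ plab P⁰ (encode fin⁰ (inj₁ (h u)))
      same-label u = trans (cong lab⁰ (decode-encode fin⁰ (inj₂ (e , ι u))))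
        (trans (e-h u) (≡-sym (cong lab⁰ (decode-encode fin⁰ (inj₁ (h u))))))

  final = iterate-step Vertex plab Bad step ≤-refl P⁰ bad⁰
  X = ecgraph (proj₁ final)
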